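{- Let $p > 5$ be a (rational integer) prime and let $i^2=-1$. Then $$S_p = \sum_{\substack{1 \leq n, m \leq p-1 \\ \gcd(p,\, m^2+n^2)=1}} \frac{1}{n+mi} \equiv 0 \pmod{p^4},$$ where the sum is over all pairs of integers $(n,m)$ with $1\le n,m\le p-1$ and $m^2+n^2$ not divisible by $p$.
   Context: The sum is computed in $\mathbb{Q}(i)$. Every summand has denominator whose norm $n^2+m^2$ is coprime to $p$, so the sum lies in the ring $R=\{a/b : a\in\mathbb{Z}[i],\ b\in\mathbb{Z},\ p\nmid b\}$. For $x,y\in R$, the congruence $x\equiv y \pmod{p^k}$ means $x-y\in p^kR$, i.e. $x-y=p^k a/b$ with $a\in\mathbb{Z}[i]$, $b\in\mathbb{Z}$, $p\nmid b$. -}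

module Defs where

open import Data.Integer.Base as ℤ using (ℤ; +_)
import Data.Integer.Divisibility as ℤ
open import Data.List.Base using (List; map; filter; foldr; upTo; cartesianProduct)
open import Data.Nat.Base as ℕ using (ℕ; suc)
open import Data.Nat.GCD using (gcd)
import Data.Nat.Properties as ℕ
open import Data.Product.Base using (_×_; _,_; ∃-syntax)
open import Data.Rational.Base as ℚ using (ℚ; 0ℚ; 1ℚ)
import Data.Rational.Properties as ℚ
import Data.Rational.Solver as ℚ
open import Relation.Binary.Definitions using (tri<; tri≈; tri>)
open import Relation.Binary.PropositionalEquality
open import Relation.Nullary using (¬_; yes; no; contradiction)
open import Relation.Unary using (Decidable)

infix 5 _+i_

record Gaussian (A : Set) : Set where
  constructor _+i_
  field
    re im : A

open Gaussian public

ℤ[i] ℚ[i] : Set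
ℤ[i] = Gaussian ℤ
ℚ[i] = Gaussian ℚ

0# 1# : ℚ[i]
0# = 0ℚ +i 0ℚ
1# = 1ℚ +i 0ℚ

infixl 6 _+_ _-_
infixl 7 _*_

_+_ _-_ _*_ : ℚ[i] → ℚ[i] → ℚ[i]
(a +i b) + (c +i d) = (a ℚ.+ c) +i (b ℚ.+ d)
(a +i b) - (c +i d) = (a ℚ.- c) +i (b ℚ.- d)
(a +i b) * (c +i d) = (a ℚ.* c ℚ.- b ℚ.* d) +i (a ℚ.* d ℚ.+ b ℚ.* c)

norm : ℚ[i] → ℚ
norm (a +i b) = a ℚ.* a ℚ.+ b ℚ.* b

infix 8 _⁻¹

-- Total, with the convention 0# ⁻¹ = 0#; see inverseʳ for nonzero arguments.
_⁻¹ : ℚ[i] → ℚ[i]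
z@(a +i b) ⁻¹ with norm z ℚ.≟ 0ℚ
... | yes _   = 0#
... | no  N≢0 = (a ℚ.÷ norm z) +i (ℚ.- b ℚ.÷ norm z)
  where instance _ = ℚ.≢-nonZero N≢0

private
  square-nonNeg : ∀ x → ℚ.NonNegative (x ℚ.* x)
  square-nonNeg x with ℚ.<-cmp x 0ℚ
  ... | tri< x<0 _ _ = ℚ.pos⇒nonNeg (x ℚ.* x) {{ℚ.neg*neg⇒pos x {{ℚ.negative x<0}} x {{ℚ.negative x<0}}}}
  ... | tri≈ _ refl _ = _
  ... | tri> _ _ x>0 = ℚ.pos⇒nonNeg (x ℚ.* x) {{ℚ.pos*pos⇒pos x {{ℚ.positive x>0}} x {{ℚ.positive x>0}}}}

  square-pos : ∀ x → x ≢ 0ℚ → ℚ.Positive (x ℚ.* x)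
  square-pos x x≢0 with ℚ.<-cmp x 0ℚ
  ... | tri< x<0 _ _ = ℚ.neg*neg⇒pos x {{ℚ.negative x<0}} x {{ℚ.negative x<0}}
  ... | tri≈ _ x≡0 _ = contradiction x≡0 x≢0
  ... | tri> _ _ x>0 = ℚ.pos*pos⇒pos x {{ℚ.positive x>0}} x {{ℚ.positive x>0}}

  pos⇒≢0 : ∀ {x} → ℚ.Positive x → x ≢ 0ℚ
  pos⇒≢0 () refl

norm≡0⇒≡0 : ∀ z → norm z ≡ 0ℚ → z ≡ 0#
norm≡0⇒≡0 (a +i b) N≡0 with a ℚ.≟ 0ℚ | b ℚ.≟ 0ℚ
... | yes refl | yes refl = refl
... | no a≢0 | _ = contradiction N≡0 (pos⇒≢0
  (ℚ.pos+nonNeg⇒pos (a ℚ.* a) {{square-pos a a≢0}} (b ℚ.* b) {{square-nonNeg b}}))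
... | yes _ | no b≢0 = contradiction N≡0 (pos⇒≢0
  (ℚ.nonNeg+pos⇒pos (a ℚ.* a) {{square-nonNeg a}} (b ℚ.* b) {{square-pos b b≢0}}))

inverseʳ : ∀ z → z ≢ 0# → z * z ⁻¹ ≡ 1#
inverseʳ z@(a +i b) z≢0 with norm z ℚ.≟ 0ℚ
... | yes N≡0 = contradiction (norm≡0⇒≡0 z N≡0) z≢0
... | no  N≢0 = cong₂ _+i_ (trans (re-eq a b k) (ℚ.*-inverseʳ (norm z))) (im-eq a b k)
  where
  instance _ = ℚ.≢-nonZero N≢0
  k = ℚ.1/ norm z
  open ℚ.+-*-Solver
  re-eq : ∀ a b k → a ℚ.* (a ℚ.* k) ℚ.- b ℚ.* (ℚ.- b ℚ.* k) ≡ (a ℚ.* a ℚ.+ b ℚ.* b) ℚ.* k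
  re-eq = solve 3 (λ a b k → a :* (a :* k) :- b :* (:- b :* k) := (a :* a :+ b :* b) :* k) refl
  im-eq : ∀ a b k → a ℚ.* (ℚ.- b ℚ.* k) ℚ.+ b ℚ.* (a ℚ.* k) ≡ 0ℚ
  im-eq = solve 3 (λ a b k → a :* (:- b :* k) :+ b :* (a :* k) := con 0ℚ) refl

fromℤ[i] : ℤ[i] → ℚ[i]
fromℤ[i] (a +i b) = (a ℚ./ 1) +i (b ℚ./ 1)

fromℤ : ℤ → ℚ[i]
fromℤ a = fromℤ[i] (a +i + 0)

-- The ring R of fractions a / b with a ∈ ℤ[i], b ∈ ℤ and p ∤ b.
R : ℕ → ℚ[i] → Set
R p x = ∃[ a ] ∃[ b ] ¬ (+ p ℤ.∣ b) × x ≡ fromℤ[i] a * fromℤ b ⁻¹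

-- x ≡ y (mod pᵏ), that is, x - y ∈ pᵏ R.
infix 4 _≡_[mod_^_]

_≡_[mod_^_] : ℚ[i] → ℚ[i] → ℕ → ℕ → Set
x ≡ y [mod p ^ k ] = ∃[ r ] R p r × x - y ≡ fromℤ (+ (p ℕ.^ k)) * r

sum : List ℚ[i] → ℚ[i]
sum = foldr _+_ 0#

-- The integers 1, …, p - 1.
range : ℕ → List ℕ
range p = map suc (upTo (p ℕ.∸ 1))

Admissible : ℕ → ℕ × ℕ → Set
Admissible p (n , m) = gcd p (m ℕ.^ 2 ℕ.+ n ℕ.^ 2) ≡ 1

admissible? : ∀ p → Decidable (Admissible p)
admissible? p (n , m) = gcd p (m ℕ.^ 2 ℕ.+ n ℕ.^ 2) ℕ.≟ 1

S : ℕ → ℚ[i]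
S p = sum (map (λ (n , m) → fromℤ[i] (+ n +i + m) ⁻¹)
               (filter (admissible? p) (cartesianProduct (range p) (range p))))

{-# OPTIONS --safe #-}

-- The rotation z ↦ p + iz permutes the square 1 ≤ n, m ≤ p - 1 and preserves the condition
-- p ∤ n² + m². Over an orbit z₀, z₁, z₂, z₃ the reciprocals add up to p³(i - 1) / (z₀z₁z₂z₃), and
-- z₀z₁z₂z₃ ≡ -z₀⁴ (mod p), so 4 S p ≡ p³(1 - i) Σ z⁻⁴ (mod p⁴). Doubling permutes the
-- residues modulo p, so 16 Σ z⁻⁴ ≡ Σ z⁻⁴ and hence Σ z⁻⁴ ≡ 0 (mod p) because p ∤ 15.
module Submission where

open import Defs
open import Data.Nat.Base using (ℕ; _>_)
open import Data.Nat.Primality using (Prime)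

open import Algebra.Bundles using (CommutativeRing)
import Algebra.Properties.Group as GroupProperties
import Algebra.Properties.Semiring.Sum as SemiringSum
import Algebra.Solver.Ring.AlmostCommutativeRing as ACR
import Algebra.Solver.Ring.Simple as RingSolver
open import Data.Fin.Base using (toℕ)
open import Data.Fin.Permutation using (reverse)
import Data.Fin.Properties as Fin
open import Data.Integer.Base as ℤ using (ℤ; +_; -[1+_])
import Data.Integer.Divisibility as ℤᵘ
import Data.Integer.Divisibility.Signed as ℤ
import Data.Integer.Properties as ℤ
import Data.Integer.Solver as ℤ
open import Data.List.Base using (List; []; _∷_; _++_; map; filter; upTo; applyUpTo; cartesianProduct)
import Data.List.Properties as List
open import Data.Nat.Base as ℕ using (zero; suc)
import Data.Nat.Divisibility as ℕ
open import Data.Nat.GCD using (gcd[m,n]∣m; gcd[m,n]∣n; gcd-greatest)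
open import Data.Nat.Primality using (euclidsLemma; prime⇒irreducible; prime⇒nonTrivial)
import Data.Nat.Properties as ℕ
import Data.Nat.Solver as ℕ
open import Data.Product.Base using (_×_; _,_; ∃-syntax; uncurry)
open import Data.Rational.Base as ℚ using (0ℚ; 1ℚ)
import Data.Rational.Properties as ℚ
import Data.Rational.Solver as ℚ
open import Data.Rational.Unnormalised.Base as ℚᵘ using (mkℚᵘ; *≡*)
import Data.Rational.Unnormalised.Properties as ℚᵘ
open import Data.Sum.Base using (_⊎_; inj₁; inj₂; [_,_]′)
open import Function.Base using (_∘_)
open import Level using (0ℓ)
open import Relation.Binary.Bundles using (Setoid)
open import Relation.Binary.Definitions using (DecidableEquality)
open import Relation.Binary.PropositionalEquality
import Relation.Binary.Reasoning.Setoid as SetoidReasoning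
open import Relation.Nullary using (¬_; Dec; yes; no; contradiction)
open import Relation.Nullary.Decidable using (map′; _×-dec_)
open import Relation.Unary using (Pred; Decidable)

-- The rotation is the quarter turn about the centre c = p(1 + i)/2 of the square, so the points of
-- an orbit are the roots of (X - c)⁴ - (z₀ - c)⁴. The coefficient of X in this polynomial is -4c³,
-- free of z₀; this makes the third elementary symmetric function of every orbit equal to 4c³ = p³(i
-- - 1). Three factors p therefore come from an exact identity in ℚ(i), and only one more has to be
-- found. For this reason every intermediate congruence is modulo p alone. Doubling acts on each
-- coordinate separately and p divides N(2z) exactly when it divides N(z), so no structure of ℤ[i]/p
-- enters and the cases p ≡ 1 and p ≡ 3 (mod 4) are not separated. The bound p > 5 makes 4 and 15 =
-- 2⁴ - 1 invertible modulo p.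

neg : ℚ[i] → ℚ[i]
neg (a +i b) = (ℚ.- a) +i (ℚ.- b)

-- Ring structure of ℚ(i)

module _ where
  open ℚ.+-*-Solver

  *-assoc : ∀ x y z → (x * y) * z ≡ x * (y * z)
  *-assoc (a +i b) (c +i d) (e +i f) = cong₂ _+i_
    (solve 6 (λ a b c d e f → (a :* c :- b :* d) :* e :- (a :* d :+ b :* c) :* f
                           := a :* (c :* e :- d :* f) :- b :* (c :* f :+ d :* e)) refl a b c d e f)
    (solve 6 (λ a b c d e f → (a :* c :- b :* d) :* f :+ (a :* d :+ b :* c) :* e
                           := a :* (c :* f :+ d :* e) :+ b :* (c :* e :- d :* f)) refl a b c d e f)

  *-comm : ∀ x y → x * y ≡ y * x
  *-comm (a +i b) (c +i d) = cong₂ _+i_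
    (solve 4 (λ a b c d → a :* c :- b :* d := c :* a :- d :* b) refl a b c d)
    (solve 4 (λ a b c d → a :* d :+ b :* c := c :* b :+ d :* a) refl a b c d)

  *-identityˡ : ∀ x → 1# * x ≡ x
  *-identityˡ (a +i b) = cong₂ _+i_
    (solve 2 (λ a b → con 1ℚ :* a :- con 0ℚ :* b := a) refl a b)
    (solve 2 (λ a b → con 1ℚ :* b :+ con 0ℚ :* a := b) refl a b)

  *-distribˡ-+ : ∀ x y z → x * (y + z) ≡ x * y + x * z
  *-distribˡ-+ (a +i b) (c +i d) (e +i f) = cong₂ _+i_
    (solve 6 (λ a b c d e f → a :* (c :+ e) :- b :* (d :+ f)
                           := (a :* c :- b :* d) :+ (a :* e :- b :* f)) refl a b c d e f)
    (solve 6 (λ a b c d e f → a :* (d :+ f) :+ b :* (c :+ e)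
                           := (a :* d :+ b :* c) :+ (a :* f :+ b :* e)) refl a b c d e f)

*-identityʳ : ∀ x → x * 1# ≡ x
*-identityʳ x = trans (*-comm x 1#) (*-identityˡ x)

*-distribʳ-+ : ∀ x y z → (y + z) * x ≡ y * x + z * x
*-distribʳ-+ x y z = trans (*-comm (y + z) x)
  (trans (*-distribˡ-+ x y z) (cong₂ _+_ (*-comm x y) (*-comm x z)))

ℚ[i]-commutativeRing : CommutativeRing 0ℓ 0ℓ
ℚ[i]-commutativeRing = record
  { Carrier = ℚ[i] ; _≈_ = _≡_ ; _+_ = _+_ ; _*_ = _*_ ; -_ = neg ; 0# = 0# ; 1# = 1#
  ; isCommutativeRing = record
    { isRing = record
      { +-isAbelianGroup = record
        { isGroup = record
          { isMonoid = record
            { isSemigroup = record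
              { isMagma = record { isEquivalence = isEquivalence ; ∙-cong = cong₂ _+_ }
              ; assoc = λ x y z → cong₂ _+i_ (ℚ.+-assoc (re x) (re y) (re z)) (ℚ.+-assoc (im x) (im y) (im z))
              }
            ; identity = (λ x → cong₂ _+i_ (ℚ.+-identityˡ (re x)) (ℚ.+-identityˡ (im x)))
                       , (λ x → cong₂ _+i_ (ℚ.+-identityʳ (re x)) (ℚ.+-identityʳ (im x)))
            }
          ; inverse = (λ x → cong₂ _+i_ (ℚ.+-inverseˡ (re x)) (ℚ.+-inverseˡ (im x)))
                    , (λ x → cong₂ _+i_ (ℚ.+-inverseʳ (re x)) (ℚ.+-inverseʳ (im x)))
          ; ⁻¹-cong = cong neg
          }
        ; comm = λ x y → cong₂ _+i_ (ℚ.+-comm (re x) (re y)) (ℚ.+-comm (im x) (im y))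
        }
      ; *-cong = cong₂ _*_
      ; *-assoc = *-assoc
      ; *-identity = *-identityˡ , *-identityʳ
      ; distrib = *-distribˡ-+ , *-distribʳ-+
      }
    ; *-comm = *-comm
    }
  }

open CommutativeRing ℚ[i]-commutativeRing using (semiring; +-identityˡ; +-assoc; +-comm; zeroʳ)

-- The ring solver takes its coefficients from `ℚ[i]` itself and compares them with this test, so
-- that relations such as i² = -1 between constants are settled by evaluation.
_≟_ : DecidableEquality ℚ[i]
x ≟ y = map′ (uncurry (cong₂ _+i_)) (λ { refl → refl , refl }) (re x ℚ.≟ re y ×-dec im x ℚ.≟ im y)

module Solver = RingSolver (ACR.fromCommutativeRing ℚ[i]-commutativeRing) _≟_

-- Gaussian integers

infixl 6 _⊕_
infixl 7 _⊗_

_⊕_ _⊗_ : ℤ[i] → ℤ[i] → ℤ[i]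
(a +i b) ⊕ (c +i d) = (a ℤ.+ c) +i (b ℤ.+ d)
(a +i b) ⊗ (c +i d) = (a ℤ.* c ℤ.- b ℤ.* d) +i (a ℤ.* d ℤ.+ b ℤ.* c)

normᶻ : ℤ[i] → ℤ
normᶻ (a +i b) = a ℤ.* a ℤ.+ b ℤ.* b

conj : ℤ[i] → ℤ[i]
conj (a +i b) = a +i ℤ.- b

iᶻ : ℤ[i]
iᶻ = + 0 +i + 1

module _ where
  open ℤ.+-*-Solver

  normᶻ-⊗ : ∀ z w → normᶻ (z ⊗ w) ≡ normᶻ z ℤ.* normᶻ w
  normᶻ-⊗ (a +i b) (c +i d) =
    solve 4 (λ a b c d → (a :* c :- b :* d) :* (a :* c :- b :* d) :+ (a :* d :+ b :* c) :* (a :* d :+ b :* c)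
                      := (a :* a :+ b :* b) :* (c :* c :+ d :* d)) refl a b c d

  ⊗-conj : ∀ z → z ⊗ conj z ≡ normᶻ z +i + 0
  ⊗-conj (a +i b) = cong₂ _+i_
    (solve 2 (λ a b → a :* a :- b :* (:- b) := a :* a :+ b :* b) refl a b)
    (solve 2 (λ a b → a :* (:- b) :+ b :* a := con (+ 0)) refl a b)

  -- Makes divisibility of the norm by p a property of the residue class of z. The cofactor is 2
  -- Re(z · conj w) + p N(w).
  normᶻ-⊕-multiple : ∀ p z w → ∃[ t ] normᶻ (z ⊕ (p +i + 0) ⊗ w) ≡ normᶻ z ℤ.+ t ℤ.* p
  normᶻ-⊕-multiple p (a +i b) (c +i d) =
    + 2 ℤ.* a ℤ.* c ℤ.+ + 2 ℤ.* b ℤ.* d ℤ.+ p ℤ.* c ℤ.* c ℤ.+ p ℤ.* d ℤ.* d ,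
    solve 5 (λ p a b c d → let u = a :+ (p :* c :- con (+ 0) :* d)
                               v = b :+ (p :* d :+ con (+ 0) :* c) in
      u :* u :+ v :* v := (a :* a :+ b :* b)
        :+ (con (+ 2) :* a :* c :+ con (+ 2) :* b :* d :+ p :* c :* c :+ p :* d :* d) :* p) refl p a b c d

/1-+ : ∀ a b → (a ℤ.+ b) ℚ./ 1 ≡ (a ℚ./ 1) ℚ.+ (b ℚ./ 1)
/1-+ a b = ℚ.toℚᵘ-injective (begin-equality
  ℚ.toℚᵘ ((a ℤ.+ b) ℚ./ 1)                 ≃⟨ ℚ.toℚᵘ-fromℚᵘ (mkℚᵘ (a ℤ.+ b) 0) ⟩
  mkℚᵘ (a ℤ.+ b) 0                         ≃⟨ *≡* (cong (ℤ._* + 1) (sym (cong₂ ℤ._+_ (ℤ.*-identityʳ a) (ℤ.*-identityʳ b)))) ⟩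
  mkℚᵘ a 0 ℚᵘ.+ mkℚᵘ b 0                   ≃⟨ ℚᵘ.+-cong (ℚ.toℚᵘ-fromℚᵘ (mkℚᵘ a 0)) (ℚ.toℚᵘ-fromℚᵘ (mkℚᵘ b 0)) ⟨
  ℚ.toℚᵘ (a ℚ./ 1) ℚᵘ.+ ℚ.toℚᵘ (b ℚ./ 1)  ≃⟨ ℚ.toℚᵘ-homo-+ (a ℚ./ 1) (b ℚ./ 1) ⟨
  ℚ.toℚᵘ ((a ℚ./ 1) ℚ.+ (b ℚ./ 1))         ∎)
  where open ℚᵘ.≤-Reasoning

/1-* : ∀ a b → (a ℤ.* b) ℚ./ 1 ≡ (a ℚ./ 1) ℚ.* (b ℚ./ 1)
/1-* a b = ℚ.toℚᵘ-injective (begin-equality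
  ℚ.toℚᵘ ((a ℤ.* b) ℚ./ 1)                 ≃⟨ ℚ.toℚᵘ-fromℚᵘ (mkℚᵘ (a ℤ.* b) 0) ⟩
  mkℚᵘ a 0 ℚᵘ.* mkℚᵘ b 0                   ≃⟨ ℚᵘ.*-cong (ℚ.toℚᵘ-fromℚᵘ (mkℚᵘ a 0)) (ℚ.toℚᵘ-fromℚᵘ (mkℚᵘ b 0)) ⟨
  ℚ.toℚᵘ (a ℚ./ 1) ℚᵘ.* ℚ.toℚᵘ (b ℚ./ 1)  ≃⟨ ℚ.toℚᵘ-homo-* (a ℚ./ 1) (b ℚ./ 1) ⟨
  ℚ.toℚᵘ ((a ℚ./ 1) ℚ.* (b ℚ./ 1))         ∎)
  where open ℚᵘ.≤-Reasoning

/1-neg : ∀ a → (ℤ.- a) ℚ./ 1 ≡ ℚ.- (a ℚ./ 1)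
/1-neg (+ zero)  = refl
/1-neg (+ suc n) = refl
/1-neg -[1+ n ]  = sym (GroupProperties.⁻¹-involutive ℚ.+-0-group (ℚ.normalize (suc n) 1))

/1-injective : ∀ {a b} → a ℚ./ 1 ≡ b ℚ./ 1 → a ≡ b
/1-injective {a} {b} eq with ℚ.fromℚᵘ-injective {mkℚᵘ a 0} {mkℚᵘ b 0} eq
... | *≡* a1≡b1 = trans (sym (ℤ.*-identityʳ a)) (trans a1≡b1 (ℤ.*-identityʳ b))

fromℤ[i]-⊕ : ∀ z w → fromℤ[i] (z ⊕ w) ≡ fromℤ[i] z + fromℤ[i] w
fromℤ[i]-⊕ (a +i b) (c +i d) = cong₂ _+i_ (/1-+ a c) (/1-+ b d)

fromℤ[i]-⊗ : ∀ z w → fromℤ[i] (z ⊗ w) ≡ fromℤ[i] z * fromℤ[i] w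
fromℤ[i]-⊗ (a +i b) (c +i d) = cong₂ _+i_
  (trans (/1-+ (a ℤ.* c) (ℤ.- (b ℤ.* d)))
    (cong₂ ℚ._+_ (/1-* a c) (trans (/1-neg (b ℤ.* d)) (cong ℚ.-_ (/1-* b d)))))
  (trans (/1-+ (a ℤ.* d) (b ℤ.* c)) (cong₂ ℚ._+_ (/1-* a d) (/1-* b c)))

fromℤ-* : ∀ a b → fromℤ (a ℤ.* b) ≡ fromℤ a * fromℤ b
fromℤ-* a b = trans (cong fromℤ[i] (cong₂ _+i_ (re-eq a b) (im-eq a b))) (fromℤ[i]-⊗ (a +i + 0) (b +i + 0))
  where
  open ℤ.+-*-Solver
  re-eq : ∀ a b → a ℤ.* b ≡ a ℤ.* b ℤ.- + 0 ℤ.* + 0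
  re-eq = solve 2 (λ a b → a :* b := a :* b :- con (+ 0) :* con (+ 0)) refl
  im-eq : ∀ a b → + 0 ≡ a ℤ.* + 0 ℤ.+ + 0 ℤ.* b
  im-eq = solve 2 (λ a b → con (+ 0) := a :* con (+ 0) :+ con (+ 0) :* b) refl

fromℤ[i]-injective : ∀ {z w} → fromℤ[i] z ≡ fromℤ[i] w → z ≡ w
fromℤ[i]-injective eq = cong₂ _+i_ (/1-injective (cong re eq)) (/1-injective (cong im eq))

fromℤ-≢0 : ∀ {a} → a ≢ + 0 → fromℤ a ≢ 0#
fromℤ-≢0 {a} a≢0 eq = a≢0 (cong re (fromℤ[i]-injective {a +i + 0} {+ 0 +i + 0} eq))

-- Finite sums

open SemiringSum semiring using (sum-cong-≗; ∑-distrib-+; ∑-comm; sum-permute; *-distribˡ-sum)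
  renaming (sum to sumᶠ)

Σ : ℕ → (ℕ → ℚ[i]) → ℚ[i]
Σ n g = sumᶠ {n} (g ∘ toℕ)

Σ-cong : ∀ n {g h} → g ≗ h → Σ n g ≡ Σ n h
Σ-cong n g≗h = sum-cong-≗ {n} (g≗h ∘ toℕ)

Σ-reverse : ∀ n g → Σ n g ≡ Σ n (λ k → g (n ℕ.∸ suc k))
Σ-reverse n g = trans (sum-permute {n} (g ∘ toℕ) reverse) (sum-cong-≗ {n} (cong g ∘ Fin.opposite-prop))

Σ-split : ∀ m n g → Σ (m ℕ.+ n) g ≡ Σ m g + Σ n (λ k → g (m ℕ.+ k))
Σ-split zero    n g = sym (+-identityˡ _)
Σ-split (suc m) n g = trans (cong (λ s → g 0 + s) (Σ-split m n (g ∘ suc)))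
  (sym (+-assoc (g 0) (Σ m (g ∘ suc)) (Σ n (λ k → g (suc m ℕ.+ k)))))

Σ-interleave : ∀ n g → Σ (n ℕ.+ n) g ≡ Σ n (λ k → g (k ℕ.+ k)) + Σ n (λ k → g (suc (k ℕ.+ k)))
Σ-interleave zero    g = refl
Σ-interleave (suc n) g rewrite ℕ.+-suc n n = begin
  g 0 + (g 1 + Σ (n ℕ.+ n) (g ∘ suc ∘ suc))
    ≡⟨ cong (λ s → g 0 + (g 1 + s)) (Σ-interleave n (g ∘ suc ∘ suc)) ⟩
  g 0 + (g 1 + (Σ n (λ k → g (suc (suc (k ℕ.+ k)))) + Σ n (λ k → g (suc (suc (suc (k ℕ.+ k)))))))
    ≡⟨ Solver.solve 4 (λ a b c d → a :+ (b :+ (c :+ d)) := (a :+ c) :+ (b :+ d)) refl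
         (g 0) (g 1) (Σ n (λ k → g (suc (suc (k ℕ.+ k))))) (Σ n (λ k → g (suc (suc (suc (k ℕ.+ k)))))) ⟩
  (g 0 + Σ n (λ k → g (suc (suc (k ℕ.+ k))))) + (g 1 + Σ n (λ k → g (suc (suc (suc (k ℕ.+ k))))))
    ≡⟨ cong₂ (λ s t → (g 0 + s) + (g 1 + t))
         (Σ-cong n (λ k → cong (g ∘ suc) (sym (ℕ.+-suc k k))))
         (Σ-cong n (λ k → cong (g ∘ suc ∘ suc) (sym (ℕ.+-suc k k)))) ⟩
  (g 0 + Σ n (λ k → g (suc k ℕ.+ suc k))) + (g 1 + Σ n (λ k → g (suc (suc k ℕ.+ suc k)))) ∎
  where
  open Solver using (_:+_; _:=_)
  open ≡-Reasoning

-- Both coordinates run over 1, …, n, while Σ n starts at 0.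
□ : ℕ → (ℤ[i] → ℚ[i]) → ℚ[i]
□ n g = Σ n (λ a → Σ n (λ b → g (+ suc a +i + suc b)))

□-cong : ∀ n {g h} → g ≗ h → □ n g ≡ □ n h
□-cong n {g} {h} g≗h = Σ-cong n (λ a → Σ-cong n {λ b → g (+ suc a +i + suc b)} {λ b → h (+ suc a +i + suc b)}
  (λ b → g≗h (+ suc a +i + suc b)))

□-+ : ∀ n g h → □ n (λ z → g z + h z) ≡ □ n g + □ n h
□-+ n g h = trans
  (Σ-cong n {h = λ a → G a + H a}
    (λ a → ∑-distrib-+ {n} (λ b → g (+ suc a +i + suc (toℕ b))) (λ b → h (+ suc a +i + suc (toℕ b)))))
  (∑-distrib-+ {n} (G ∘ toℕ) (H ∘ toℕ))
  where
  G H : ℕ → ℚ[i]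
  G a = Σ n (λ b → g (+ suc a +i + suc b))
  H a = Σ n (λ b → h (+ suc a +i + suc b))

□-*ˡ : ∀ n c g → □ n (λ z → c * g z) ≡ c * □ n g
□-*ˡ n c g = sym (trans (*-distribˡ-sum {n} c (λ a → Σ n (λ b → g (+ suc (toℕ a) +i + suc b))))
                        (Σ-cong n (λ a → *-distribˡ-sum {n} c (λ b → g (+ suc a +i + suc (toℕ b))))))

-- The map z ↦ p + iz in coordinates, the form in which its action on the square can be read off;
-- `rot-⊕` recovers the ring form.
rotate : ℕ → ℤ[i] → ℤ[i]
rotate p (x +i y) = (+ p ℤ.- y) +i x

-- The rotation sends (a , b) to (p - b , a): exchange the two summations, then reverse one of them.
-- With p = n + 1 the reversal of the indices 0, ..., n - 1 is x ↦ p - x on the coordinates 1, ...,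
-- n.
□-rotate : ∀ n g → □ n (g ∘ rotate (suc n)) ≡ □ n g
□-rotate n g = trans (∑-comm {n} {n} (λ a b → g (rotate (suc n) (+ suc (toℕ a) +i + suc (toℕ b)))))
  (sym (trans (Σ-reverse n (λ a → Σ n (λ b → g (+ suc a +i + suc b))))
    (sum-cong-≗ {n} (λ k → Σ-cong n (λ b → cong (λ x → g (x +i + suc b)) (reflect (Fin.toℕ<n k)))))))
  where
  reflect : ∀ {k} → k ℕ.< n → + suc (n ℕ.∸ suc k) ≡ + suc n ℤ.- + suc k
  reflect {k} k<n = begin
    + suc (n ℕ.∸ suc k)  ≡⟨ cong +_ (ℕ.+-∸-assoc 1 k<n) ⟨
    + (suc n ℕ.∸ suc k)  ≡⟨ ℤ.⊖-≥ (ℕ.m≤n⇒m≤1+n k<n) ⟨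
    suc n ℤ.⊖ suc k      ≡⟨ ℤ.m-n≡m⊖n (suc n) (suc k) ⟨
    + suc n ℤ.- + suc k  ∎
    where open ≡-Reasoning

-- Sums over lists

sum-map-filter : ∀ {A : Set} {P : Pred A 0ℓ} (P? : Decidable P) (g h : A → ℚ[i]) →
                 (∀ x → P x → g x ≡ h x) → (∀ x → ¬ P x → h x ≡ 0#) →
                 ∀ xs → sum (map g (filter P? xs)) ≡ sum (map h xs)
sum-map-filter P? g h agree vanish [] = refl
sum-map-filter P? g h agree vanish (x ∷ xs) with P? x
... | yes Px = cong₂ _+_ (agree x Px) (sum-map-filter P? g h agree vanish xs)
... | no ¬Px = trans (sum-map-filter P? g h agree vanish xs)
                     (sym (trans (cong (_+ sum (map h xs)) (vanish x ¬Px)) (+-identityˡ _)))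

sum-++ : ∀ xs ys → sum (xs ++ ys) ≡ sum xs + sum ys
sum-++ []       ys = sym (+-identityˡ _)
sum-++ (x ∷ xs) ys = trans (cong (λ s → x + s) (sum-++ xs ys)) (sym (+-assoc x (sum xs) (sum ys)))

sum-cartesianProduct : ∀ {A B : Set} (g : A × B → ℚ[i]) xs ys →
  sum (map g (cartesianProduct xs ys)) ≡ sum (map (λ x → sum (map (λ y → g (x , y)) ys)) xs)
sum-cartesianProduct g []       ys = refl
sum-cartesianProduct g (x ∷ xs) ys = begin
  sum (map g (map (x ,_) ys ++ cartesianProduct xs ys))
    ≡⟨ cong sum (List.map-++ g (map (x ,_) ys) _) ⟩
  sum (map g (map (x ,_) ys) ++ map g (cartesianProduct xs ys))
    ≡⟨ sum-++ (map g (map (x ,_) ys)) _ ⟩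
  sum (map g (map (x ,_) ys)) + sum (map g (cartesianProduct xs ys))
    ≡⟨ cong₂ _+_ (cong sum (sym (List.map-∘ ys))) (sum-cartesianProduct g xs ys) ⟩
  sum (map (λ y → g (x , y)) ys) + sum (map (λ x → sum (map (λ y → g (x , y)) ys)) xs) ∎
  where open ≡-Reasoning

sum-applyUpTo : ∀ g (f : ℕ → ℕ) n → sum (map g (applyUpTo f n)) ≡ Σ n (g ∘ f)
sum-applyUpTo g f zero    = refl
sum-applyUpTo g f (suc n) = cong (λ s → g (f 0) + s) (sum-applyUpTo g (f ∘ suc) n)

sum-range : ∀ n g → sum (map g (range (suc n))) ≡ Σ n (g ∘ suc)
sum-range n g = trans (cong sum (sym (List.map-∘ (upTo n)))) (sum-applyUpTo (g ∘ suc) (λ k → k) n)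

-- Congruences

I : ℚ[i]
I = fromℤ[i] iᶻ

-- Multiplying each reciprocal by the other three zₖ uₖ = 1 leaves the third elementary symmetric
-- function of the zₖ, which is p³(i - 1) independently of z.
quarter-turns : ∀ p z u₀ u₁ u₂ u₃ → let r = λ x → I * x + p in
  z * u₀ ≡ 1# → r z * u₁ ≡ 1# → r (r z) * u₂ ≡ 1# → r (r (r z)) * u₃ ≡ 1# →
  u₀ + u₁ + u₂ + u₃ ≡ p * p * p * (I - 1#) * (u₀ * u₁ * u₂ * u₃)
quarter-turns p z u₀ u₁ u₂ u₃ e₀ e₁ e₂ e₃ = begin
  u₀ + u₁ + u₂ + u₃
    ≡⟨ solve 4 (λ a b c d → let e = con 1# in
         a :+ b :+ c :+ d := (a :* e) :* e :* e :+ (e :* b) :* e :* e :+ e :* e :* (c :* e) :+ e :* e :* (e :* d))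
         refl u₀ u₁ u₂ u₃ ⟩
  g 1# 1# 1# 1#
    ≡⟨ trans (cong (λ a → g a 1# 1# 1#) (sym e₀)) (trans (cong (λ b → g (z * u₀) b 1# 1#) (sym e₁))
       (trans (cong (λ c → g (z * u₀) (r z * u₁) c 1#) (sym e₂)) (cong (g (z * u₀) (r z * u₁) (r (r z) * u₂)) (sym e₃)))) ⟩
  g (z * u₀) (r z * u₁) (r (r z) * u₂) (r (r (r z)) * u₃)
    ≡⟨ solve 6 (λ p z a b c d →
         let i = con I; r₁ = i :* z :+ p; r₂ = i :* r₁ :+ p; r₃ = i :* r₂ :+ p in
         (a :* (r₁ :* b)) :* (r₂ :* c) :* (r₃ :* d) :+ ((z :* a) :* b) :* (r₂ :* c) :* (r₃ :* d)
           :+ (z :* a) :* (r₁ :* b) :* (c :* (r₃ :* d)) :+ (z :* a) :* (r₁ :* b) :* ((r₂ :* c) :* d)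
         := p :* p :* p :* (i :- con 1#) :* (a :* b :* c :* d)) refl p z u₀ u₁ u₂ u₃ ⟩
  p * p * p * (I - 1#) * (u₀ * u₁ * u₂ * u₃) ∎
  where
  open ≡-Reasoning
  open Solver
  r = λ x → I * x + p
  g : ℚ[i] → ℚ[i] → ℚ[i] → ℚ[i] → ℚ[i]
  g a b c d = (u₀ * b) * c * d + (a * u₁) * c * d + a * b * (u₂ * d) + a * b * (c * u₃)

-- The ring `R p` and congruence modulo p

module Localization (p : ℕ) (p-prime : Prime p) where

  P : ℚ[i]
  P = fromℤ (+ p)

  Pᶻ : ℤ[i]
  Pᶻ = + p +i + 0

  infix 4 p∣_ p∤_

  p∣_ p∤_ : ℤ → Set
  p∣ a = + p ℤᵘ.∣ a
  p∤ a = ¬ (p∣ a)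

  p∣? : Decidable p∣_
  p∣? a = p ℕ.∣? ℤ.∣ a ∣

  p∣*⇒ : ∀ a b → p∣ a ℤ.* b → p∣ a ⊎ p∣ b
  p∣*⇒ a b p∣ab = euclidsLemma ℤ.∣ a ∣ ℤ.∣ b ∣ p-prime (subst (p ℕ.∣_) (ℤ.abs-* a b) p∣ab)

  p∤-* : ∀ a b → p∤ a → p∤ b → p∤ a ℤ.* b
  p∤-* a b p∤a p∤b = [ p∤a , p∤b ]′ ∘ p∣*⇒ a b

  p∤1 : p∤ + 1
  p∤1 p∣1 = ℕ.<⇒≱ (ℕ.nonTrivial⇒n>1 p {{prime⇒nonTrivial p-prime}}) (ℕ.∣⇒≤ p∣1)

  p∤⇒≢0 : ∀ {a} → p∤ a → a ≢ + 0
  p∤⇒≢0 p∤0 refl = p∤0 (p ℕ.∣0)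

  fromℤ-inverseʳ : ∀ b → p∤ b → fromℤ b * fromℤ b ⁻¹ ≡ 1#
  fromℤ-inverseʳ b p∤b = inverseʳ (fromℤ b) (fromℤ-≢0 (p∤⇒≢0 {b} p∤b))

  -- Together with `R-elim` this replaces a fraction by its cross-multiplied equation, so that
  -- closure under sums and products becomes polynomial algebra without `_⁻¹`.
  R-intro : ∀ {x} a b → p∤ b → x * fromℤ b ≡ fromℤ[i] a → R p x
  R-intro {x} a b p∤b xb≡a = a , b , p∤b , (begin
    x                          ≡⟨ *-identityʳ x ⟨
    x * 1#                     ≡⟨ cong (λ y → x * y) (fromℤ-inverseʳ b p∤b) ⟨
    x * (fromℤ b * fromℤ b ⁻¹) ≡⟨ *-assoc x (fromℤ b) (fromℤ b ⁻¹) ⟨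
    x * fromℤ b * fromℤ b ⁻¹   ≡⟨ cong (λ y → y * fromℤ b ⁻¹) xb≡a ⟩
    fromℤ[i] a * fromℤ b ⁻¹    ∎)
    where open ≡-Reasoning

  R-elim : ∀ {x} → R p x → ∃[ a ] ∃[ b ] p∤ b × x * fromℤ b ≡ fromℤ[i] a
  R-elim (a , b , p∤b , refl) = a , b , p∤b , (begin
    fromℤ[i] a * fromℤ b ⁻¹ * fromℤ b   ≡⟨ *-assoc (fromℤ[i] a) (fromℤ b ⁻¹) (fromℤ b) ⟩
    fromℤ[i] a * (fromℤ b ⁻¹ * fromℤ b) ≡⟨ cong (λ y → fromℤ[i] a * y) (trans (*-comm (fromℤ b ⁻¹) (fromℤ b)) (fromℤ-inverseʳ b p∤b)) ⟩
    fromℤ[i] a * 1#                     ≡⟨ *-identityʳ (fromℤ[i] a) ⟩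
    fromℤ[i] a                          ∎)
    where open ≡-Reasoning

  R-fromℤ[i] : ∀ a → R p (fromℤ[i] a)
  R-fromℤ[i] a = R-intro a (+ 1) p∤1 (*-identityʳ (fromℤ[i] a))

  R-fromℤ⁻¹ : ∀ b → p∤ b → R p (fromℤ b ⁻¹)
  R-fromℤ⁻¹ b p∤b = R-intro (+ 1 +i + 0) b p∤b (trans (*-comm (fromℤ b ⁻¹) (fromℤ b)) (fromℤ-inverseʳ b p∤b))

  R-+ : ∀ {x y} → R p x → R p y → R p (x + y)
  R-+ {x} {y} Rx Ry with R-elim Rx | R-elim Ry
  ... | a , b , p∤b , xb≡a | c , d , p∤d , yd≡c =
    R-intro (a ⊗ (d +i + 0) ⊕ c ⊗ (b +i + 0)) (b ℤ.* d) (p∤-* b d p∤b p∤d) (begin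
      (x + y) * fromℤ (b ℤ.* d)
        ≡⟨ cong (λ k → (x + y) * k) (fromℤ-* b d) ⟩
      (x + y) * (fromℤ b * fromℤ d)
        ≡⟨ Solver.solve 4 (λ x y b d → (x :+ y) :* (b :* d) := (x :* b) :* d :+ (y :* d) :* b) refl x y (fromℤ b) (fromℤ d) ⟩
      x * fromℤ b * fromℤ d + y * fromℤ d * fromℤ b
        ≡⟨ cong₂ (λ s t → s * fromℤ d + t * fromℤ b) xb≡a yd≡c ⟩
      fromℤ[i] a * fromℤ d + fromℤ[i] c * fromℤ b
        ≡⟨ cong₂ _+_ (fromℤ[i]-⊗ a (d +i + 0)) (fromℤ[i]-⊗ c (b +i + 0)) ⟨
      fromℤ[i] (a ⊗ (d +i + 0)) + fromℤ[i] (c ⊗ (b +i + 0))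
        ≡⟨ fromℤ[i]-⊕ (a ⊗ (d +i + 0)) (c ⊗ (b +i + 0)) ⟨
      fromℤ[i] (a ⊗ (d +i + 0) ⊕ c ⊗ (b +i + 0)) ∎)
    where
    open Solver using (_:+_; _:*_; _:=_)
    open ≡-Reasoning

  R-* : ∀ {x y} → R p x → R p y → R p (x * y)
  R-* {x} {y} Rx Ry with R-elim Rx | R-elim Ry
  ... | a , b , p∤b , xb≡a | c , d , p∤d , yd≡c =
    R-intro (a ⊗ c) (b ℤ.* d) (p∤-* b d p∤b p∤d) (begin
      x * y * fromℤ (b ℤ.* d)
        ≡⟨ cong (λ k → x * y * k) (fromℤ-* b d) ⟩
      x * y * (fromℤ b * fromℤ d)
        ≡⟨ Solver.solve 4 (λ x y b d → x :* y :* (b :* d) := (x :* b) :* (y :* d)) refl x y (fromℤ b) (fromℤ d) ⟩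
      (x * fromℤ b) * (y * fromℤ d)
        ≡⟨ cong₂ _*_ xb≡a yd≡c ⟩
      fromℤ[i] a * fromℤ[i] c
        ≡⟨ fromℤ[i]-⊗ a c ⟨
      fromℤ[i] (a ⊗ c) ∎)
    where
    open Solver using (_:*_; _:=_)
    open ≡-Reasoning

  R-0# : R p 0#
  R-0# = R-fromℤ[i] (+ 0 +i + 0)

  R-neg1# : R p (neg 1#)
  R-neg1# = R-fromℤ[i] (-[1+ 0 ] +i + 0)

  infix 4 _≋_

  -- Only the first power of p is needed here. As a record type it determines x and y, which
  -- unfolding to an equation about `x - y` would not.
  record _≋_ (x y : ℚ[i]) : Set where
    constructor ≋-by
    field
      quotient   : ℚ[i]
      integral   : R p quotient
      difference : x - y ≡ P * quotient

  module _ where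
    open Solver
    open ≡-Reasoning

    ≡⇒≋ : ∀ {x y} → x ≡ y → x ≋ y
    ≡⇒≋ {x} refl = ≋-by 0# R-0# (solve 2 (λ x p → x :- x := p :* con 0#) refl x P)

    ≋-sym : ∀ {x y} → x ≋ y → y ≋ x
    ≋-sym {x} {y} (≋-by r Rr eq) = ≋-by (neg 1# * r) (R-* R-neg1# Rr) (begin
      y - x              ≡⟨ solve 2 (λ x y → y :- x := con (neg 1#) :* (x :- y)) refl x y ⟩
      neg 1# * (x - y)   ≡⟨ cong (λ d → neg 1# * d) eq ⟩
      neg 1# * (P * r)   ≡⟨ solve 2 (λ p r → con (neg 1#) :* (p :* r) := p :* (con (neg 1#) :* r)) refl P r ⟩
      P * (neg 1# * r)   ∎)

    ≋-trans : ∀ {x y z} → x ≋ y → y ≋ z → x ≋ z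
    ≋-trans {x} {y} {z} (≋-by r Rr eq) (≋-by s Rs eq′) = ≋-by (r + s) (R-+ Rr Rs) (begin
      x - z              ≡⟨ solve 3 (λ x y z → x :- z := (x :- y) :+ (y :- z)) refl x y z ⟩
      (x - y) + (y - z)  ≡⟨ cong₂ _+_ eq eq′ ⟩
      P * r + P * s      ≡⟨ *-distribˡ-+ P r s ⟨
      P * (r + s)        ∎)

    ≋-+ : ∀ {x x′ y y′} → x ≋ x′ → y ≋ y′ → x + y ≋ x′ + y′
    ≋-+ {x} {x′} {y} {y′} (≋-by r Rr eq) (≋-by s Rs eq′) = ≋-by (r + s) (R-+ Rr Rs) (begin
      (x + y) - (x′ + y′)    ≡⟨ solve 4 (λ x x′ y y′ → (x :+ y) :- (x′ :+ y′) := (x :- x′) :+ (y :- y′)) refl x x′ y y′ ⟩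
      (x - x′) + (y - y′)    ≡⟨ cong₂ _+_ eq eq′ ⟩
      P * r + P * s          ≡⟨ *-distribˡ-+ P r s ⟨
      P * (r + s)            ∎)

    -- Elements of ℚ(i) may have p in the denominator, so products respect congruence only under
    -- integrality: the quotient x * s + r * y′ has x and y′ as factors, hence the two membership
    -- hypotheses.
    ≋-* : ∀ {x x′ y y′} → R p x → R p y′ → x ≋ x′ → y ≋ y′ → x * y ≋ x′ * y′
    ≋-* {x} {x′} {y} {y′} Rx Ry′ (≋-by r Rr eq) (≋-by s Rs eq′) = ≋-by (x * s + r * y′) (R-+ (R-* Rx Rs) (R-* Rr Ry′)) (begin
      x * y - x′ * y′                 ≡⟨ solve 4 (λ x x′ y y′ → x :* y :- x′ :* y′ := x :* (y :- y′) :+ (x :- x′) :* y′) refl x x′ y y′ ⟩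
      x * (y - y′) + (x - x′) * y′    ≡⟨ cong₂ (λ d e → x * d + e * y′) eq′ eq ⟩
      x * (P * s) + P * r * y′        ≡⟨ solve 5 (λ x y′ r s p → x :* (p :* s) :+ p :* r :* y′ := p :* (x :* s :+ r :* y′)) refl x y′ r s P ⟩
      P * (x * s + r * y′)            ∎)

    ≋-*ˡ : ∀ {c x y} → R p c → x ≋ y → c * x ≋ c * y
    ≋-*ˡ {c} {x} {y} Rc (≋-by r Rr eq) = ≋-by (c * r) (R-* Rc Rr) (begin
      c * x - c * y     ≡⟨ solve 3 (λ c x y → c :* x :- c :* y := c :* (x :- y)) refl c x y ⟩
      c * (x - y)       ≡⟨ cong (λ d → c * d) eq ⟩
      c * (P * r)       ≡⟨ solve 3 (λ c p r → c :* (p :* r) := p :* (c :* r)) refl c P r ⟩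
      P * (c * r)       ∎)

  ≋-setoid : Setoid 0ℓ 0ℓ
  ≋-setoid = record
    { Carrier = ℚ[i]
    ; _≈_ = _≋_
    ; isEquivalence = record { refl = ≡⇒≋ refl ; sym = ≋-sym ; trans = ≋-trans }
    }

  module ≋-Reasoning = SetoidReasoning ≋-setoid

  Σ-≋ : ∀ n {g h} → (∀ k → g k ≋ h k) → Σ n g ≋ Σ n h
  Σ-≋ zero    g≋h = ≡⇒≋ refl
  Σ-≋ (suc n) g≋h = ≋-+ (g≋h 0) (Σ-≋ n (g≋h ∘ suc))

  □-≋ : ∀ n {g h} → (∀ z → g z ≋ h z) → □ n g ≋ □ n h
  □-≋ n g≋h = Σ-≋ n (λ a → Σ-≋ n (λ b → g≋h (+ suc a +i + suc b)))

  -- For p = 2q + 1, the numbers 2, 4, …, 2q and 2q + 2, …, 4q reduce to the even and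
  -- odd numbers between 1 and 2q.
  Σ-double : ∀ q → p ≡ suc (q ℕ.+ q) → ∀ g → (∀ k → g (p ℕ.+ k) ≋ g k) →
             Σ (q ℕ.+ q) (λ k → g (suc k ℕ.+ suc k)) ≋ Σ (q ℕ.+ q) (g ∘ suc)
  Σ-double q refl g periodic = begin
    Σ (q ℕ.+ q) (λ k → g (suc k ℕ.+ suc k))
      ≡⟨ Σ-split q q (λ k → g (suc k ℕ.+ suc k)) ⟩
    evens + Σ q (λ k → g (suc (q ℕ.+ k) ℕ.+ suc (q ℕ.+ k)))
      ≡⟨ cong (λ s → evens + s) (Σ-cong q (λ k → cong g (wrap q k))) ⟩
    evens + Σ q (λ k → g (p ℕ.+ suc (k ℕ.+ k)))
      ≈⟨ ≋-+ (≡⇒≋ {evens} refl) (Σ-≋ q (λ k → periodic (suc (k ℕ.+ k)))) ⟩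
    evens + odds
      ≡⟨ +-comm evens odds ⟩
    odds + evens
      ≡⟨ cong (λ s → odds + s) (Σ-cong q (λ k → cong (g ∘ suc) (ℕ.+-suc k k))) ⟩
    odds + Σ q (λ k → g (suc (suc (k ℕ.+ k))))
      ≡⟨ Σ-interleave q (g ∘ suc) ⟨
    Σ (q ℕ.+ q) (g ∘ suc) ∎
    where
    open ℕ.+-*-Solver
    open ≋-Reasoning
    evens = Σ q (λ k → g (suc k ℕ.+ suc k))
    odds  = Σ q (λ k → g (suc (k ℕ.+ k)))
    wrap : ∀ q k → suc (q ℕ.+ k) ℕ.+ suc (q ℕ.+ k) ≡ suc (q ℕ.+ q) ℕ.+ suc (k ℕ.+ k)
    wrap = solve 2 (λ q k → (con 1 :+ (q :+ k)) :+ (con 1 :+ (q :+ k)) := (con 1 :+ (q :+ q)) :+ (con 1 :+ (k :+ k))) refl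

  -- Reciprocals modulo p

  -- Setting recip z = 0 when p ∣ normᶻ z turns the filtered sum into a sum over the whole square.
  recip : ℤ[i] → ℚ[i]
  recip z with p∣? (normᶻ z)
  ... | yes _ = 0#
  ... | no  _ = fromℤ[i] z ⁻¹

  recip-vanishes : ∀ z → p∣ normᶻ z → recip z ≡ 0#
  recip-vanishes z p∣N with p∣? (normᶻ z)
  ... | yes _   = refl
  ... | no  p∤N = contradiction p∣N p∤N

  recip-⁻¹ : ∀ z → p∤ normᶻ z → recip z ≡ fromℤ[i] z ⁻¹
  recip-⁻¹ z p∤N with p∣? (normᶻ z)
  ... | yes p∣N = contradiction p∣N p∤N
  ... | no  _   = refl

  recip-inverseʳ : ∀ z → p∤ normᶻ z → fromℤ[i] z * recip z ≡ 1#
  recip-inverseʳ z p∤N = trans (cong (λ u → fromℤ[i] z * u) (recip-⁻¹ z p∤N)) (inverseʳ (fromℤ[i] z) z≢0)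
    where
    z≢0 : fromℤ[i] z ≢ 0#
    z≢0 eq = p∤⇒≢0 p∤N (cong normᶻ (fromℤ[i]-injective {z} {+ 0 +i + 0} eq))

  -- Rationalising the denominator, 1/z = conj z / N(z), and N(z) is prime to p in the nonzero case.
  R-recip : ∀ z → R p (recip z)
  R-recip z with p∣? (normᶻ z)
  ... | yes _   = R-0#
  ... | no  p∤N = subst (R p) (recip-⁻¹ z p∤N) (R-intro (conj z) (normᶻ z) p∤N (begin
    recip z * fromℤ (normᶻ z)                       ≡⟨ cong (λ w → recip z * fromℤ[i] w) (⊗-conj z) ⟨
    recip z * fromℤ[i] (z ⊗ conj z)                 ≡⟨ cong (λ w → recip z * w) (fromℤ[i]-⊗ z (conj z)) ⟩
    recip z * (fromℤ[i] z * fromℤ[i] (conj z))      ≡⟨ *-assoc (recip z) (fromℤ[i] z) (fromℤ[i] (conj z)) ⟨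
    recip z * fromℤ[i] z * fromℤ[i] (conj z)        ≡⟨ cong (λ w → w * fromℤ[i] (conj z)) (trans (*-comm (recip z) (fromℤ[i] z)) (recip-inverseʳ z p∤N)) ⟩
    1# * fromℤ[i] (conj z)                          ≡⟨ *-identityˡ (fromℤ[i] (conj z)) ⟩
    fromℤ[i] (conj z)                               ∎))
    where open ≡-Reasoning

  -- The norm is multiplicative, so p divides N(εz) exactly when it divides N(z): either both
  -- reciprocals are zero by convention or both are true inverses. Applied to ε = i and to ε = 2.
  recip-⊗ : ∀ ε z → p∤ normᶻ ε → fromℤ[i] ε * recip (ε ⊗ z) ≡ recip z
  recip-⊗ ε z p∤Nε with p∣? (normᶻ z)
  ... | yes p∣N = begin
    fromℤ[i] ε * recip (ε ⊗ z)  ≡⟨ cong (λ u → fromℤ[i] ε * u) (recip-vanishes (ε ⊗ z) p∣Nεz) ⟩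
    fromℤ[i] ε * 0#             ≡⟨ zeroʳ (fromℤ[i] ε) ⟩
    0#                          ∎
    where
    open ≡-Reasoning
    p∣Nεz : p∣ normᶻ (ε ⊗ z)
    p∣Nεz = subst p∣_ (sym (normᶻ-⊗ ε z)) (ℤ.∣⇒∣ᵤ (ℤ.∣n⇒∣m*n (normᶻ ε) (ℤ.∣ᵤ⇒∣ {+ p} {normᶻ z} p∣N)))
  ... | no p∤N = begin
    e * v                       ≡⟨ *-identityʳ (e * v) ⟨
    e * v * 1#                  ≡⟨ cong (λ w → e * v * w) (recip-inverseʳ z p∤N) ⟨
    e * v * (fromℤ[i] z * u)    ≡⟨ solve 4 (λ e v z u → e :* v :* (z :* u) := (e :* z) :* v :* u) refl e v (fromℤ[i] z) u ⟩
    e * fromℤ[i] z * v * u      ≡⟨ cong (λ w → w * v * u) (fromℤ[i]-⊗ ε z) ⟨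
    fromℤ[i] (ε ⊗ z) * v * u    ≡⟨ cong (λ w → w * u) (recip-inverseʳ (ε ⊗ z) (p∤Nεz)) ⟩
    1# * u                      ≡⟨ *-identityˡ u ⟩
    u                           ≡⟨ recip-⁻¹ z p∤N ⟩
    fromℤ[i] z ⁻¹               ∎
    where
    open ≡-Reasoning
    open Solver
    e = fromℤ[i] ε
    u = recip z
    v = recip (ε ⊗ z)
    p∤Nεz : p∤ normᶻ (ε ⊗ z)
    p∤Nεz = subst p∤_ (sym (normᶻ-⊗ ε z)) (p∤-* (normᶻ ε) (normᶻ z) p∤Nε p∤N)

  p∣-⊕ : ∀ z w → p∣ normᶻ z → p∣ normᶻ (z ⊕ Pᶻ ⊗ w)
  p∣-⊕ z w p∣N = let t , eq = normᶻ-⊕-multiple (+ p) z w in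
    subst p∣_ (sym eq) (ℤ.∣⇒∣ᵤ (ℤ.∣m∣n⇒∣m+n (ℤ.∣ᵤ⇒∣ {+ p} {normᶻ z} p∣N) (ℤ.divides t refl)))

  p∣-⊕⁻ : ∀ z w → p∣ normᶻ (z ⊕ Pᶻ ⊗ w) → p∣ normᶻ z
  p∣-⊕⁻ z w p∣N = let t , eq = normᶻ-⊕-multiple (+ p) z w in
    ℤ.∣⇒∣ᵤ (ℤ.∣m+n∣n⇒∣m {m = normᶻ z} (ℤ.∣ᵤ⇒∣ {+ p} (subst p∣_ eq p∣N)) (ℤ.divides t refl))

  -- With z′ = z + pw one has 1/z′ - 1/z = -pw / (z z′), which gives the quotient below. If p
  -- divides N(z) it also divides N(z′), and both sides are zero.
  recip-≋ : ∀ z w → recip (z ⊕ Pᶻ ⊗ w) ≋ recip z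
  recip-≋ z w = go (p∣? (normᶻ z))
    where
    open ≡-Reasoning
    open Solver
    z′ = z ⊕ Pᶻ ⊗ w
    u = recip z
    u′ = recip z′
    go : Dec (p∣ normᶻ z) → u′ ≋ u
    go (yes p∣N) = ≡⇒≋ (trans (recip-vanishes z′ (p∣-⊕ z w p∣N)) (sym (recip-vanishes z p∣N)))
    go (no p∤N)  = ≋-by (neg 1# * fromℤ[i] w * (u * u′))
      (R-* (R-* R-neg1# (R-fromℤ[i] w)) (R-* (R-recip z) (R-recip z′))) (begin
      u′ - u
        ≡⟨ cong₂ _-_ (*-identityʳ u′) (*-identityʳ u) ⟨
      u′ * 1# - u * 1#
        ≡⟨ cong₂ (λ s t → u′ * s - u * t) (recip-inverseʳ z p∤N) (recip-inverseʳ z′ (p∤N ∘ p∣-⊕⁻ z w)) ⟨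
      u′ * (fromℤ[i] z * u) - u * (fromℤ[i] z′ * u′)
        ≡⟨ cong (λ x → u′ * (fromℤ[i] z * u) - u * (x * u′))
             (trans (fromℤ[i]-⊕ z (Pᶻ ⊗ w)) (cong (λ y → fromℤ[i] z + y) (fromℤ[i]-⊗ Pᶻ w))) ⟩
      u′ * (fromℤ[i] z * u) - u * ((fromℤ[i] z + P * fromℤ[i] w) * u′)
        ≡⟨ solve 5 (λ z w u u′ p → u′ :* (z :* u) :- u :* ((z :+ p :* w) :* u′) := p :* (con (neg 1#) :* w :* (u :* u′)))
             refl (fromℤ[i] z) (fromℤ[i] w) u u′ P ⟩
      P * (neg 1# * fromℤ[i] w * (u * u′)) ∎)

  -- Orbits of the quarter turn

  rot : ℤ[i] → ℤ[i]
  rot = rotate p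

  rot-⊕ : ∀ z → rot z ≡ iᶻ ⊗ z ⊕ Pᶻ ⊗ (+ 1 +i + 0)
  rot-⊕ (a +i b) = cong₂ _+i_
    (solve 3 (λ a b p → p :- b := (con (+ 0) :* a :- con (+ 1) :* b) :+ (p :* con (+ 1) :- con (+ 0) :* con (+ 0))) refl a b (+ p))
    (solve 3 (λ a b p → a := (con (+ 0) :* b :+ con (+ 1) :* a) :+ (p :* con (+ 0) :+ con (+ 0) :* con (+ 1))) refl a b (+ p))
    where open ℤ.+-*-Solver

  fromℤ[i]-rot : ∀ z → fromℤ[i] (rot z) ≡ I * fromℤ[i] z + P
  fromℤ[i]-rot z = begin
    fromℤ[i] (rot z)                                       ≡⟨ cong fromℤ[i] (rot-⊕ z) ⟩
    fromℤ[i] (iᶻ ⊗ z ⊕ Pᶻ ⊗ (+ 1 +i + 0))                  ≡⟨ fromℤ[i]-⊕ (iᶻ ⊗ z) (Pᶻ ⊗ (+ 1 +i + 0)) ⟩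
    fromℤ[i] (iᶻ ⊗ z) + fromℤ[i] (Pᶻ ⊗ (+ 1 +i + 0))       ≡⟨ cong₂ _+_ (fromℤ[i]-⊗ iᶻ z) (fromℤ[i]-⊗ Pᶻ (+ 1 +i + 0)) ⟩
    I * fromℤ[i] z + P * 1#                                ≡⟨ cong (λ x → I * fromℤ[i] z + x) (*-identityʳ P) ⟩
    I * fromℤ[i] z + P                                     ∎
    where open ≡-Reasoning

  normᶻ-iᶻ⊗ : ∀ z → normᶻ (iᶻ ⊗ z) ≡ normᶻ z
  normᶻ-iᶻ⊗ z = trans (normᶻ-⊗ iᶻ z) (ℤ.*-identityˡ (normᶻ z))

  p∣-rot : ∀ z → p∣ normᶻ z → p∣ normᶻ (rot z)
  p∣-rot z p∣N = subst (p∣_ ∘ normᶻ) (sym (rot-⊕ z))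
    (p∣-⊕ (iᶻ ⊗ z) (+ 1 +i + 0) (subst p∣_ (sym (normᶻ-iᶻ⊗ z)) p∣N))

  p∤-rot : ∀ z → p∤ normᶻ z → p∤ normᶻ (rot z)
  p∤-rot z p∤N p∣N = p∤N (subst p∣_ (normᶻ-iᶻ⊗ z)
    (p∣-⊕⁻ (iᶻ ⊗ z) (+ 1 +i + 0) (subst (p∣_ ∘ normᶻ) (rot-⊕ z) p∣N)))

  -- Modulo p the rotation is multiplication by i, and 1/i = -i.
  recip-rot : ∀ z → recip (rot z) ≋ neg I * recip z
  recip-rot z = begin
    recip (rot z)                          ≡⟨ cong recip (rot-⊕ z) ⟩
    recip (iᶻ ⊗ z ⊕ Pᶻ ⊗ (+ 1 +i + 0))     ≈⟨ recip-≋ (iᶻ ⊗ z) (+ 1 +i + 0) ⟩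
    v                                      ≡⟨ solve 1 (λ v → v := con (neg I) :* (con I :* v)) refl v ⟩
    -- `normᶻ iᶻ` evaluates to `+ 1`, so `p∤1` is the condition on the multiplier i.
    neg I * (I * v)                        ≡⟨ cong (λ u → neg I * u) (recip-⊗ iᶻ z p∤1) ⟩
    neg I * recip z                        ∎
    where
    open ≋-Reasoning
    open Solver
    v = recip (iᶻ ⊗ z)

  rotProduct : ℤ[i] → ℚ[i]
  rotProduct z = recip z * recip (rot z) * recip (rot (rot z)) * recip (rot (rot (rot z)))

  rotSum : ℤ[i] → ℚ[i]
  rotSum z = recip z + recip (rot z) + recip (rot (rot z)) + recip (rot (rot (rot z)))

  -- Divisibility of the norm by p is invariant under `rot`, so an orbit is excluded as a whole,
  -- with both sides zero, or not at all, and then `quarter-turns` applies. The result is an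
  -- equality, not merely a congruence.
  rotSum≡rotProduct : ∀ z → rotSum z ≡ P * P * P * (I - 1#) * rotProduct z
  rotSum≡rotProduct z = go (p∣? (normᶻ z))
    where
    open Solver
    z₁ = rot z
    z₂ = rot z₁
    z₃ = rot z₂
    z₂-eq : fromℤ[i] z₂ ≡ I * (I * fromℤ[i] z + P) + P
    z₂-eq = trans (fromℤ[i]-rot z₁) (cong (λ x → I * x + P) (fromℤ[i]-rot z))
    z₃-eq : fromℤ[i] z₃ ≡ I * (I * (I * fromℤ[i] z + P) + P) + P
    z₃-eq = trans (fromℤ[i]-rot z₂) (cong (λ x → I * x + P) z₂-eq)
    vanishing : ∀ {u₀ u₁ u₂ u₃} → u₀ ≡ 0# → u₁ ≡ 0# → u₂ ≡ 0# → u₃ ≡ 0# →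
                u₀ + u₁ + u₂ + u₃ ≡ P * P * P * (I - 1#) * (u₀ * u₁ * u₂ * u₃)
    vanishing refl refl refl refl =
      solve 1 (λ c → con 0# := c :* con 0#) refl (P * P * P * (I - 1#))
    go : Dec (p∣ normᶻ z) → rotSum z ≡ P * P * P * (I - 1#) * rotProduct z
    go (yes p∣N) = vanishing (recip-vanishes z p∣N) (recip-vanishes z₁ p∣N₁)
                             (recip-vanishes z₂ p∣N₂) (recip-vanishes z₃ (p∣-rot z₂ p∣N₂))
      where
      p∣N₁ = p∣-rot z p∣N
      p∣N₂ = p∣-rot z₁ p∣N₁
    go (no p∤N) = quarter-turns P (fromℤ[i] z) (recip z) (recip z₁) (recip z₂) (recip z₃)
      (recip-inverseʳ z p∤N)
      (trans (cong (λ x → x * recip z₁) (sym (fromℤ[i]-rot z))) (recip-inverseʳ z₁ p∤N₁))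
      (trans (cong (λ x → x * recip z₂) (sym z₂-eq)) (recip-inverseʳ z₂ p∤N₂))
      (trans (cong (λ x → x * recip z₃) (sym z₃-eq)) (recip-inverseʳ z₃ (p∤-rot z₂ p∤N₂)))
      where
      p∤N₁ = p∤-rot z p∤N
      p∤N₂ = p∤-rot z₁ p∤N₁

  -- Inverse fourth powers modulo p

  quartic : ℤ[i] → ℚ[i]
  quartic z = recip z * recip z * recip z * recip z

  -- Modulo p the factors are u, (-i)u, (-i)²u, (-i)³u, and (-i)⁶ = -1.
  rotProduct-≋ : ∀ z → rotProduct z ≋ neg 1# * quartic z
  rotProduct-≋ z = begin
    rotProduct z
      ≈⟨ ≋-* (R-* (R-* (R-recip z) (R-recip (rot z))) (R-recip (rot (rot z)))) R₃
           (≋-* (R-* (R-recip z) (R-recip (rot z))) R₂ (≋-* (R-recip z) R₁ (≡⇒≋ {u} refl) c₁) c₂) c₃ ⟩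
    u * (neg I * u) * (neg I * (neg I * u)) * (neg I * (neg I * (neg I * u)))
      ≡⟨ solve 1 (λ u → let j = con (neg I) in
           u :* (j :* u) :* (j :* (j :* u)) :* (j :* (j :* (j :* u))) := con (neg 1#) :* (u :* u :* u :* u)) refl u ⟩
    neg 1# * quartic z ∎
    where
    open ≋-Reasoning
    open Solver
    u = recip z
    R-negI = R-fromℤ[i] (+ 0 +i -[1+ 0 ])
    R₁ = R-* R-negI (R-recip z)
    R₂ = R-* R-negI R₁
    R₃ = R-* R-negI R₂
    c₁ : recip (rot z) ≋ neg I * u
    c₁ = recip-rot z
    c₂ : recip (rot (rot z)) ≋ neg I * (neg I * u)
    c₂ = ≋-trans (recip-rot (rot z)) (≋-*ˡ R-negI c₁)
    c₃ : recip (rot (rot (rot z))) ≋ neg I * (neg I * (neg I * u))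
    c₃ = ≋-trans (recip-rot (rot (rot z))) (≋-*ˡ R-negI c₂)

  quartic-≋ : ∀ z w → quartic (z ⊕ Pᶻ ⊗ w) ≋ quartic z
  quartic-≋ z w = ≋-* (R-* (R-* Rz′ Rz′) Rz′) Rz (≋-* (R-* Rz′ Rz′) Rz (≋-* Rz′ Rz c c) c) c
    where
    c = recip-≋ z w
    Rz = R-recip z
    Rz′ = R-recip (z ⊕ Pᶻ ⊗ w)

  2ᶻ : ℤ[i]
  2ᶻ = + 2 +i + 0

  -- Here 4 is the norm of the multiplier 2, and 16 = 2⁴. The relation is exact, since 2 · (1/(2z))
  -- = 1/z holds in ℚ(i).
  quartic-double : p∤ + 4 → ∀ z → quartic z ≡ fromℤ (+ 16) * quartic (2ᶻ ⊗ z)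
  quartic-double p∤4 z = trans (cong (λ u → u * u * u * u) (sym (recip-⊗ 2ᶻ z p∤4)))
    (solve 1 (λ v → let x = con (fromℤ (+ 2)) :* v in x :* x :* x :* x := con (fromℤ (+ 16)) :* (v :* v :* v :* v))
      refl (recip (2ᶻ ⊗ z)))
    where open Solver

  -- `quartic` has periods p and pi modulo p, so `Σ-double` can be applied to the second coordinate
  -- with the first one fixed, and then to the first.
  □-quartic-double : ∀ q → p ≡ suc (q ℕ.+ q) →
                     □ (q ℕ.+ q) (λ z → quartic (2ᶻ ⊗ z)) ≋ □ (q ℕ.+ q) quartic
  □-quartic-double q p≡ = begin
    □ n (λ z → quartic (2ᶻ ⊗ z))
      ≡⟨ □-cong n (λ z → cong quartic (double z)) ⟩
    Σ n (λ a → Σ n (λ b → G (suc a ℕ.+ suc a) (suc b ℕ.+ suc b)))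
      ≈⟨ Σ-≋ n (λ a → Σ-double q p≡ (G (suc a ℕ.+ suc a)) (periodicʳ (suc a ℕ.+ suc a))) ⟩
    Σ n (λ a → Σ n (λ b → G (suc a ℕ.+ suc a) (suc b)))
      ≈⟨ Σ-double q p≡ (λ a → Σ n (λ b → G a (suc b))) (λ a → Σ-≋ n (λ b → periodicˡ a (suc b))) ⟩
    □ n quartic ∎
    where
    open ≋-Reasoning
    open ℤ.+-*-Solver
    n = q ℕ.+ q
    G : ℕ → ℕ → ℚ[i]
    G a b = quartic (+ a +i + b)
    double : ∀ z → 2ᶻ ⊗ z ≡ (re z ℤ.+ re z) +i (im z ℤ.+ im z)
    double (a +i b) = cong₂ _+i_
      (solve 2 (λ a b → con (+ 2) :* a :- con (+ 0) :* b := a :+ a) refl a b)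
      (solve 2 (λ a b → con (+ 2) :* b :+ con (+ 0) :* a := b :+ b) refl a b)
    shiftˡ : ∀ p a b → (p ℤ.+ a) +i b ≡ (a +i b) ⊕ (p +i + 0) ⊗ (+ 1 +i + 0)
    shiftˡ p a b = cong₂ _+i_
      (solve 2 (λ p a → p :+ a := a :+ (p :* con (+ 1) :- con (+ 0) :* con (+ 0))) refl p a)
      (solve 2 (λ p b → b := b :+ (p :* con (+ 0) :+ con (+ 0) :* con (+ 1))) refl p b)
    shiftʳ : ∀ p a b → a +i (p ℤ.+ b) ≡ (a +i b) ⊕ (p +i + 0) ⊗ (+ 0 +i + 1)
    shiftʳ p a b = cong₂ _+i_
      (solve 2 (λ p a → a := a :+ (p :* con (+ 0) :- con (+ 0) :* con (+ 1))) refl p a)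
      (solve 2 (λ p b → p :+ b := b :+ (p :* con (+ 1) :+ con (+ 0) :* con (+ 0))) refl p b)
    periodicˡ : ∀ a b → G (p ℕ.+ a) b ≋ G a b
    periodicˡ a b = ≋-trans (≡⇒≋ (cong quartic (shiftˡ (+ p) (+ a) (+ b)))) (quartic-≋ (+ a +i + b) (+ 1 +i + 0))
    periodicʳ : ∀ a b → G a (p ℕ.+ b) ≋ G a b
    periodicʳ a b = ≋-trans (≡⇒≋ (cong quartic (shiftʳ (+ p) (+ a) (+ b)))) (quartic-≋ (+ a +i + b) (+ 0 +i + 1))

  □-quartic≋0 : ∀ q → p ≡ suc (q ℕ.+ q) → p∤ + 4 → p∤ + 15 → □ (q ℕ.+ q) quartic ≋ 0#
  □-quartic≋0 q p≡ p∤4 p∤15 = begin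
    □ n quartic                     ≡⟨ U≡16V ⟩
    fromℤ (+ 16) * V                ≈⟨ ≋-*ˡ (R-fromℤ[i] (+ 16 +i + 0)) V≋0 ⟩
    fromℤ (+ 16) * 0#               ≡⟨ zeroʳ (fromℤ (+ 16)) ⟩
    0#                              ∎
    where
    open ≋-Reasoning
    open Solver
    n = q ℕ.+ q
    V = □ n (λ z → quartic (2ᶻ ⊗ z))
    -- This lies in `R p` because p does not divide 15, so multiplying by it preserves congruences.
    k = fromℤ (+ 15) ⁻¹
    U≡16V : □ n quartic ≡ fromℤ (+ 16) * V
    U≡16V = trans (□-cong n (quartic-double p∤4)) (□-*ˡ n (fromℤ (+ 16)) (λ z → quartic (2ᶻ ⊗ z)))
    15V≋0 : fromℤ (+ 15) * V ≋ 0#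
    15V≋0 = begin
      fromℤ (+ 15) * V               ≡⟨ solve 1 (λ v → con (fromℤ (+ 15)) :* v := con (fromℤ (+ 16)) :* v :+ con (neg 1#) :* v) refl V ⟩
      fromℤ (+ 16) * V + neg 1# * V  ≡⟨ cong (λ u → u + neg 1# * V) (sym U≡16V) ⟩
      □ n quartic + neg 1# * V       ≈⟨ ≋-+ (≋-sym (□-quartic-double q p≡)) (≡⇒≋ {neg 1# * V} refl) ⟩
      V + neg 1# * V                 ≡⟨ solve 1 (λ v → v :+ con (neg 1#) :* v := con 0#) refl V ⟩
      0#                             ∎
    V≋0 : V ≋ 0#
    V≋0 = begin
      V                              ≡⟨ *-identityˡ V ⟨
      1# * V                         ≡⟨ cong (λ x → x * V) (trans (*-comm k (fromℤ (+ 15))) (fromℤ-inverseʳ (+ 15) p∤15)) ⟨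
      k * fromℤ (+ 15) * V           ≡⟨ *-assoc k (fromℤ (+ 15)) V ⟩
      k * (fromℤ (+ 15) * V)         ≈⟨ ≋-*ˡ (R-fromℤ⁻¹ (+ 15) p∤15) 15V≋0 ⟩
      k * 0#                         ≡⟨ zeroʳ k ⟩
      0#                             ∎

  □-rot : ∀ {n} → p ≡ suc n → ∀ g → □ n (g ∘ rot) ≡ □ n g
  □-rot {n} refl g = □-rotate n g

  -- Summing orbit sums over the whole square, instead of over orbit representatives, counts each
  -- reciprocal four times; by rotation invariance the four terms have equal totals.
  □-rotSum : ∀ {n} → p ≡ suc n → □ n rotSum ≡ fromℤ (+ 4) * □ n recip
  □-rotSum {n} p≡ = begin
    □ n rotSum
      ≡⟨ □-+ n (λ z → recip z + r₁ z + r₂ z) r₃ ⟩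
    □ n (λ z → recip z + r₁ z + r₂ z) + □ n r₃
      ≡⟨ cong (λ s → s + □ n r₃) (□-+ n (λ z → recip z + r₁ z) r₂) ⟩
    □ n (λ z → recip z + r₁ z) + □ n r₂ + □ n r₃
      ≡⟨ cong (λ s → s + □ n r₂ + □ n r₃) (□-+ n recip r₁) ⟩
    S₀ + □ n r₁ + □ n r₂ + □ n r₃
      ≡⟨ cong (λ s → S₀ + □ n r₁ + □ n r₂ + s) (□-rot p≡ r₂) ⟩
    S₀ + □ n r₁ + □ n r₂ + □ n r₂
      ≡⟨ cong (λ s → S₀ + □ n r₁ + s + s) (□-rot p≡ r₁) ⟩
    S₀ + □ n r₁ + □ n r₁ + □ n r₁
      ≡⟨ cong (λ s → S₀ + s + s + s) (□-rot p≡ recip) ⟩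
    S₀ + S₀ + S₀ + S₀
      ≡⟨ solve 1 (λ s → s :+ s :+ s :+ s := con (fromℤ (+ 4)) :* s) refl S₀ ⟩
    fromℤ (+ 4) * S₀ ∎
    where
    open ≡-Reasoning
    open Solver
    r₁ = recip ∘ rot
    r₂ = r₁ ∘ rot
    r₃ = r₂ ∘ rot
    S₀ = □ n recip

  -- From the filtered sum to the congruence modulo p⁴

  ∣normᶻ∣ : ∀ n m → ℤ.∣ normᶻ (+ n +i + m) ∣ ≡ m ℕ.^ 2 ℕ.+ n ℕ.^ 2
  ∣normᶻ∣ n m = trans (cong ℤ.∣_∣ (cong₂ ℤ._+_ (sym (ℤ.pos-* n n)) (sym (ℤ.pos-* m m))))
    (solve 2 (λ n m → n :* n :+ m :* m := m :^ 2 :+ n :^ 2) refl n m)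
    where open ℕ.+-*-Solver

  admissible⇒p∤ : ∀ n m → Admissible p (n , m) → p∤ normᶻ (+ n +i + m)
  admissible⇒p∤ n m gcd≡1 p∣N = p∤1 (subst (p ℕ.∣_) gcd≡1 (gcd-greatest ℕ.∣-refl (subst (p ℕ.∣_) (∣normᶻ∣ n m) p∣N)))

  -- The gcd divides the prime p, so it is 1 or p.
  ¬admissible⇒p∣ : ∀ n m → ¬ Admissible p (n , m) → p∣ normᶻ (+ n +i + m)
  ¬admissible⇒p∣ n m gcd≢1 with prime⇒irreducible p-prime (gcd[m,n]∣m p (m ℕ.^ 2 ℕ.+ n ℕ.^ 2))
  ... | inj₁ gcd≡1 = contradiction gcd≡1 gcd≢1
  ... | inj₂ gcd≡p = subst₂ ℕ._∣_ gcd≡p (sym (∣normᶻ∣ n m)) (gcd[m,n]∣n p (m ℕ.^ 2 ℕ.+ n ℕ.^ 2))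

  S≡□ : ∀ {n} → p ≡ suc n → S p ≡ □ n recip
  S≡□ {n} refl = begin
    S p
      ≡⟨ sum-map-filter (admissible? p) summand h
           (λ (a , b) adm → sym (recip-⁻¹ (+ a +i + b) (admissible⇒p∤ a b adm)))
           (λ (a , b) ¬adm → recip-vanishes (+ a +i + b) (¬admissible⇒p∣ a b ¬adm))
           (cartesianProduct (range p) (range p)) ⟩
    sum (map h (cartesianProduct (range p) (range p)))
      ≡⟨ sum-cartesianProduct h (range p) (range p) ⟩
    sum (map (λ a → sum (map (λ b → h (a , b)) (range p))) (range p))
      ≡⟨ cong sum (List.map-cong (λ a → sum-range n (λ b → h (a , b))) (range p)) ⟩
    sum (map (λ a → Σ n (λ b → h (a , suc b))) (range p))
      ≡⟨ sum-range n (λ a → Σ n (λ b → h (a , suc b))) ⟩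
    □ n recip ∎
    where
    open ≡-Reasoning
    summand h : ℕ × ℕ → ℚ[i]
    summand (a , b) = fromℤ[i] (+ a +i + b) ⁻¹
    h (a , b) = recip (+ a +i + b)

  fromℤ-p⁴ : fromℤ (+ (p ℕ.^ 4)) ≡ P * (P * (P * (P * 1#)))
  fromℤ-p⁴ = go 4
    where
    pow : ℕ → ℚ[i]
    pow zero    = 1#
    pow (suc k) = P * pow k
    go : ∀ k → fromℤ (+ (p ℕ.^ k)) ≡ pow k
    go zero    = refl
    go (suc k) = trans (cong fromℤ (ℤ.pos-* p (p ℕ.^ k)))
                       (trans (fromℤ-* (+ p) (+ (p ℕ.^ k))) (cong (λ x → P * x) (go k)))

  S≡0 : ∀ q → p ≡ suc (q ℕ.+ q) → p∤ + 4 → p∤ + 15 → S p ≡ 0# [mod p ^ 4 ]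
  S≡0 q p≡ p∤4 p∤15 = conclude □rotProduct≋0
    where
    open Solver
    n = q ℕ.+ q
    k = fromℤ (+ 4) ⁻¹
    □rotProduct≋0 : □ n rotProduct ≋ 0#
    □rotProduct≋0 = begin
      □ n rotProduct                    ≈⟨ □-≋ n rotProduct-≋ ⟩
      □ n (λ z → neg 1# * quartic z)    ≡⟨ □-*ˡ n (neg 1#) quartic ⟩
      neg 1# * □ n quartic              ≈⟨ ≋-*ˡ R-neg1# (□-quartic≋0 q p≡ p∤4 p∤15) ⟩
      neg 1# * 0#                       ≡⟨ zeroʳ (neg 1#) ⟩
      0#                                ∎
      where open ≋-Reasoning
    conclude : □ n rotProduct ≋ 0# → S p ≡ 0# [mod p ^ 4 ]
    -- With Q the sum of `rotProduct` over the square, 4 S = p³(i - 1) Q exactly, and the congruence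
    -- gives Q = p r. Hence S = p⁴ · (i - 1) r / 4.
    conclude (≋-by r Rr eq) = k * ((I - 1#) * r) ,
      R-* (R-fromℤ⁻¹ (+ 4) p∤4) (R-* (R-fromℤ[i] (-[1+ 0 ] +i + 1)) Rr) , (begin
      S p - 0#                          ≡⟨ cong (λ s → s - 0#) (S≡□ p≡) ⟩
      S₀ - 0#                           ≡⟨ solve 1 (λ s → s :- con 0# := con 1# :* s) refl S₀ ⟩
      1# * S₀                           ≡⟨ cong (λ x → x * S₀) (trans (*-comm k (fromℤ (+ 4))) (fromℤ-inverseʳ (+ 4) p∤4)) ⟨
      k * fromℤ (+ 4) * S₀              ≡⟨ *-assoc k (fromℤ (+ 4)) S₀ ⟩
      k * (fromℤ (+ 4) * S₀)            ≡⟨ cong (λ x → k * x) (□-rotSum p≡) ⟨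
      k * □ n rotSum                    ≡⟨ cong (λ x → k * x) (trans (□-cong n rotSum≡rotProduct) (□-*ˡ n (P * P * P * (I - 1#)) rotProduct)) ⟩
      k * (P * P * P * (I - 1#) * Q)
        ≡⟨ solve 4 (λ k p c x → k :* (p :* p :* p :* c :* x) := k :* (p :* p :* p :* c :* (x :- con 0#))) refl k P (I - 1#) Q ⟩
      k * (P * P * P * (I - 1#) * (Q - 0#))
        ≡⟨ cong (λ x → k * (P * P * P * (I - 1#) * x)) eq ⟩
      k * (P * P * P * (I - 1#) * (P * r))
        ≡⟨ solve 4 (λ k p c r → k :* (p :* p :* p :* c :* (p :* r)) := p :* (p :* (p :* (p :* con 1#))) :* (k :* (c :* r)))
             refl k P (I - 1#) r ⟩
      P * (P * (P * (P * 1#))) * (k * ((I - 1#) * r))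
        ≡⟨ cong (λ x → x * (k * ((I - 1#) * r))) fromℤ-p⁴ ⟨
      fromℤ (+ (p ℕ.^ 4)) * (k * ((I - 1#) * r)) ∎)
      where
      open ≡-Reasoning
      S₀ = □ n recip
      Q = □ n rotProduct

-- The even form is the one that witnesses divisibility by 2; the odd form makes p - 1 the length
-- `q ℕ.+ q` required by `Σ-double`.
even⊎odd : ∀ n → ∃[ q ] (n ≡ q ℕ.* 2 ⊎ n ≡ suc (q ℕ.+ q))
even⊎odd zero    = 0 , inj₁ refl
even⊎odd (suc n) with even⊎odd n
... | q , inj₁ refl = q , inj₂ (solve 1 (λ q → con 1 :+ q :* con 2 := con 1 :+ (q :+ q)) refl q)
  where open ℕ.+-*-Solver
... | q , inj₂ refl = suc q , inj₁ (solve 1 (λ q → con 2 :+ (q :+ q) := (con 1 :+ q) :* con 2) refl q)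
  where open ℕ.+-*-Solver

theorem1 : ∀ (p : ℕ) → Prime p → p > 5 → S p ≡ 0# [mod p ^ 4 ]
theorem1 p p-prime p>5 with even⊎odd p
... | q , inj₂ p≡ = S≡0 q p≡ (ℕ.>⇒∤ (ℕ.≤-trans (ℕ.m≤m+n 5 1) p>5)) p∤15
  where
  open Localization p p-prime
  p∤15 : p∤ + 15
  -- Size alone does not exclude p = 7, 11 or 13, so 15 is factored: p would divide 3 or 5, both
  -- smaller than p.
  p∤15 p∣15 with p∣*⇒ (+ 3) (+ 5) p∣15
  ... | inj₁ p∣3 = ℕ.>⇒∤ (ℕ.≤-trans (ℕ.m≤m+n 4 2) p>5) p∣3
  ... | inj₂ p∣5 = ℕ.>⇒∤ p>5 p∣5
-- An even prime equals 2, which contradicts p > 5.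
... | q , inj₁ p≡q*2 with prime⇒irreducible p-prime (ℕ.divides q p≡q*2)
...   | inj₂ refl = contradiction p>5 (ℕ.≤⇒≯ (ℕ.m≤m+n 2 3))
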